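{- For all finitely supported $p,q\subseteq\mathit{Heap}$ and all $c\in\mathit{Heap}\to(\mathit{Heap}+\{\mathit{err}\})_\bot$, the quadruple $[\mathsf{eq}(p)](\mathsf{cps}(c),\mathsf{cps}(c))[\mathsf{eq}(q)]$ holds if and only if the following two conditions hold: (1) for every $h$ in $p$, either $c(h)=\bot$ or $c(h)\in q$ (hence $c(h)$ cannot be $\mathit{err}$); (2) for every $h$ in $p$ and every heap $h_1$ such that $h\#h_1$, (a) if $c(h)=\bot$, then $c(h\bullet h_1)=\bot$, (b) if $c(h)\neq\bot$, then $c(h)\bullet h_1$ is defined and equal to $c(h\bullet h_1)$.
   Context: **FM domain theory.** $\mathit{Loc}$ is a countably infinite set. A permutation is a bijection $\pi$ of $\mathit{Loc}$ with $\pi(l)\neq l$ for only finitely many $l$. An FM-set is a set $A$ with an action of permutations ($\mathrm{id}\cdot a=a$, $\pi\cdot(\pi'\cdot a)=(\pi\circ\pi')\cdot a$) such that every $a\in A$ is supported by some finite $L\subseteq\mathit{Loc}$, i.e. ($\forall l\in L.\ \pi(l)=l$) implies $\pi\cdot a=a$. An FM-poset is an FM-set with a partial order preserved by the action; an FM-cpo is an FM-poset in which every $\omega$-chain whose elements are all supported by one common finite set has a least upper bound. The function space $A\to B$ of FM-cpos consists of the finitely supported (for $(\pi\cdot f)(a)=\pi\cdot f(\pi^{ -1}\cdot a)$) monotone functions preserving lubs of finitely supported chains. A subset $p\subseteq\mathit{Heap}$ is finitely supported if there is a finite $L\subseteq\mathit{Loc}$ such that every $\pi$ fixing $L$ pointwise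 satisfies $h\in p\iff\pi\cdot h\in p$. **Semantic domains.** $\mathit{Val}=\mathit{Loc}+\mathit{Int}+\{\mathit{default}\}$ (discrete; $\pi$ acts on locations only). $\mathit{O}=\{\mathit{normal},\mathit{err}\}_\bot$ (flat, trivial action), $\mathit{G}=\{\mathit{normal},\bot\}\subseteq\mathit O$. $\mathit{Heap}$ is the (discretely ordered) FM-cpo of finite partial functions from $\mathit{Loc}$ to $\mathit{Val}\times\mathit{Val}$, with $(\pi\cdot h)(l)=\pi\cdot h(\pi^{ -1}(l))$ for $l\in\pi(\mathrm{dom}\,h)$. $\mathit{Cont}=(\mathit{Heap}\to\mathit{O})$. $h\#h'$ means $\mathrm{dom}(h)\cap\mathrm{dom}(h')=\emptyset$; $h\bullet h'$ is the union of $h$ and $h'$, defined only when $h\#h'$. **Relations and quadruples.** $\mathcal R$ is the set of finitely supported binary relations $r$ on $\mathit{Heap}$ (for some finite $L\subseteq\mathit{Loc}$, every $\pi$ fixing $L$ pointwise satisfies $h_0[r]h_1\iff(\pi\cdot h_0)[r](\pi\cdot h_1)$). $h_0[r*s]h_1$ iff there are splittings $h_0=n_0\bullet m_0$, $h_1=n_1\bullet m_1$ with $n_0[r]n_1$ and $m_0[s]m_1$. $\mathsf{eq}(D_0)=\{(d,d)\mid d\in D_0\}$. $k_0[r\to\mathsf{eq}(\mathit{G})]k_1$ means $k_0(h_0)[\mathsf{eq}(\mathit{G})]k_1(h_1)$ whenever $h_0[r]h_1$. For $c_0,c_1\in(\mathit{Heap}\times\mathit{Cont}\to\mathit{O})$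 and $r,s\in\mathcal R$, the semantic quadruple $[r](c_0,c_1)[s]$ holds iff for all $r'\in\mathcal R$, $h_0,h_1\in\mathit{Heap}$, $k_0,k_1\in\mathit{Cont}$: $h_0[r*r']h_1$ and $k_0[s*r'\to\mathsf{eq}(\mathit{G})]k_1$ imply $c_0(h_0,k_0)[\mathsf{eq}(\mathit{G})]c_1(h_1,k_1)$. **CPS transform.** $\mathsf{cps}:(\mathit{Heap}\to(\mathit{Heap}+\{\mathit{err}\})_\bot)\to(\mathit{Heap}\times\mathit{Cont}\to\mathit{O})$ is given by $\mathsf{cps}(c)(h,k)=k(c(h))$ if $c(h)\notin\{\bot,\mathit{err}\}$, and $\mathsf{cps}(c)(h,k)=c(h)$ otherwise. -}

module Defs where

open import Axiom.ExcludedMiddle using (ExcludedMiddle)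
open import Data.Empty using (⊥; ⊥-elim)
open import Data.Integer.Base using (ℤ)
open import Data.List.Base using (List; []; _∷_; _++_; map; concatMap)
open import Data.List.Membership.Propositional using (_∈_)
open import Data.List.Membership.Propositional.Properties
  using (∈-++⁺ˡ; ∈-++⁺ʳ; ∈-map⁺; ∈-concatMap⁺)
open import Data.List.Relation.Unary.Any as Any using (here; there)
open import Data.Maybe.Base as Maybe using (Maybe; just; nothing; _<∣>_)
open import Data.Maybe.Properties using (map-id; map-∘; map-cong)
open import Data.Nat.Base using (ℕ; zero; suc; _+_)
open import Data.Nat.Properties using (+-comm)
import Data.Nat.Properties as ℕ
open import Data.Product using (Σ; ∃₂; Σ-syntax; ∃-syntax; _×_; _,_; proj₁; proj₂)
open import Data.Product.Relation.Binary.Pointwise.NonDependent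
  using (×-setoid; ×-isPartialOrder)
open import Data.Sum.Base using (_⊎_; inj₁; inj₂)
open import Data.Sum.Relation.Binary.Pointwise using (⊎-setoid; inj₁; inj₂)
open import Data.Unit.Base using (⊤; tt)
open import Function.Base using (_∘_; id)
open import Function.Bundles using (_↔_; _⇔_; Inverse; Equivalence; mk⇔)
open import Function.Properties.Inverse using (↔-refl; ↔-sym; ↔-trans; Inverse⇒Injection)
open import Level using (0ℓ)
open import Relation.Binary.Bundles using (Setoid)
open import Relation.Binary.Core using (Rel)
import Relation.Binary.Construct.Add.Infimum.Equality as AddBottomEq
import Relation.Binary.Construct.Add.Infimum.NonStrict as AddBottomOrd
open import Relation.Binary.Definitions using (DecidableEquality)
open import Relation.Binary.PropositionalEquality as ≡
  using (_≡_; _≢_; refl; cong; cong₂; subst; subst₂)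
import Relation.Binary.Reasoning.Setoid as SetoidReasoning
open import Relation.Binary.Structures using (IsPartialOrder)
open import Relation.Nullary using (¬_; yes; no; contradiction)
open import Relation.Nullary.Construct.Add.Infimum using (_₋; ⊥₋; [_])
open import Relation.Nullary.Decidable using (via-injection)
open import Relation.Unary using (Pred)

-- Excluded middle renders the classical ambient logic; the definitions below
-- use it only to show that lifted domains have lubs of chains.  FM-sets are
-- based on setoids because heaps and function spaces are compared
-- extensionally; subsets and relations must therefore respect that equality.
module Semantics (em : ExcludedMiddle 0ℓ) (Loc : Set) (countable : Loc ↔ ℕ) where

  _≟_ : DecidableEquality Loc
  _≟_ = via-injection (Inverse⇒Injection countable) ℕ._≟_

  record Perm : Set where
    field
      bijection : Loc ↔ Loc
    open Inverse bijection public using (to; from)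
    field
      finite : ∃[ L ] (∀ l → to l ≢ l → l ∈ L)

    to-from : ∀ l → to (from l) ≡ l
    to-from = Inverse.strictlyInverseˡ bijection

    from-to : ∀ l → from (to l) ≡ l
    from-to = Inverse.strictlyInverseʳ bijection

  infixl 10 _⟨$⟩_
  _⟨$⟩_ : Perm → Loc → Loc
  _⟨$⟩_ = Perm.to

  idₚ : Perm
  idₚ = record { bijection = ↔-refl ; finite = [] , λ l l≢l → contradiction refl l≢l }

  infixr 9 _∘ₚ_
  _∘ₚ_ : Perm → Perm → Perm
  π ∘ₚ π′ = record
    { bijection = ↔-trans (Perm.bijection π′) (Perm.bijection π)
    ; finite    = L ++ L′ , moved
    }
    where
    open Σ (Perm.finite π) renaming (proj₁ to L; proj₂ to fin)
    open Σ (Perm.finite π′) renaming (proj₁ to L′; proj₂ to fin′)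
    moved : ∀ l → π ⟨$⟩ (π′ ⟨$⟩ l) ≢ l → l ∈ L ++ L′
    moved l ≢l with (π′ ⟨$⟩ l) ≟ l
    ... | no  π′l≢l = ∈-++⁺ʳ L (fin′ l π′l≢l)
    ... | yes π′l≡l = ∈-++⁺ˡ (fin l λ πl≡l → ≢l (≡.trans (cong (π ⟨$⟩_) π′l≡l) πl≡l))

  infix 11 _⁻¹
  _⁻¹ : Perm → Perm
  π ⁻¹ = record
    { bijection = ↔-sym (Perm.bijection π)
    ; finite    = proj₁ (Perm.finite π) , λ l ≢l → proj₂ (Perm.finite π) l λ πl≡l →
        ≢l (≡.trans (cong (Perm.from π) (≡.sym πl≡l)) (Perm.from-to π l))
    }

  infix 4 _Fixes_
  _Fixes_ : Perm → List Loc → Set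
  π Fixes L = ∀ {l} → l ∈ L → π ⟨$⟩ l ≡ l

  fixes-⁻¹ : ∀ {π L} → π Fixes L → π ⁻¹ Fixes L
  fixes-⁻¹ {π} fix {l} l∈L = ≡.trans (cong (Perm.from π) (≡.sym (fix l∈L))) (Perm.from-to π l)

  fixes-++ˡ : ∀ {π L L′} → π Fixes (L ++ L′) → π Fixes L
  fixes-++ˡ fix = fix ∘ ∈-++⁺ˡ

  fixes-++ʳ : ∀ {π} L {L′} → π Fixes (L ++ L′) → π Fixes L′
  fixes-++ʳ L fix = fix ∘ ∈-++⁺ʳ L

  record FMSet : Set₁ where
    infixr 8 _·_
    field
      setoid : Setoid 0ℓ 0ℓ
    open Setoid setoid public renaming (refl to ≈-refl; sym to ≈-sym; trans to ≈-trans)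
      hiding (isEquivalence)
    field
      _·_    : Perm → Carrier → Carrier
      ·-cong : ∀ π {a b} → a ≈ b → π · a ≈ π · b
      ·-id   : ∀ a → idₚ · a ≈ a
      ·-∘    : ∀ π π′ a → π · (π′ · a) ≈ (π ∘ₚ π′) · a

    Supports : List Loc → Carrier → Set
    Supports L a = ∀ π → π Fixes L → π · a ≈ a

    field
      supported : ∀ a → ∃[ L ] Supports L a

    module ≈-Reasoning = SetoidReasoning setoid

    ·-trivial : ∀ π → (∀ l → π ⟨$⟩ l ≡ l) → ∀ a → π · a ≈ a
    ·-trivial π fix a = proj₂ (supported a) π (λ {l} _ → fix l)

    ·-⁻¹ʳ : ∀ π a → π · π ⁻¹ · a ≈ a
    ·-⁻¹ʳ π a = ≈-trans (·-∘ π (π ⁻¹) a) (·-trivial (π ∘ₚ π ⁻¹) (Perm.to-from π) a)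

    ·-⁻¹ˡ : ∀ π a → π ⁻¹ · π · a ≈ a
    ·-⁻¹ˡ π a = ≈-trans (·-∘ (π ⁻¹) π a) (·-trivial (π ⁻¹ ∘ₚ π) (Perm.from-to π) a)

    ·-ext : ∀ π π′ → (∀ l → π ⟨$⟩ l ≡ π′ ⟨$⟩ l) → ∀ a → π · a ≈ π′ · a
    ·-ext π π′ eq a = begin
      π · a                ≈⟨ ·-⁻¹ʳ π′ (π · a) ⟨
      π′ · π′ ⁻¹ · π · a   ≈⟨ ·-cong π′ (·-∘ (π′ ⁻¹) π a) ⟩
      π′ · (π′ ⁻¹ ∘ₚ π) · a
        ≈⟨ ·-cong π′ (·-trivial (π′ ⁻¹ ∘ₚ π)
             (λ l → ≡.trans (cong (Perm.from π′) (eq l)) (Perm.from-to π′ l)) a) ⟩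
      π′ · a               ∎
      where open ≈-Reasoning

    ·-ext₂ : ∀ π π′ σ σ′ → (∀ l → π ⟨$⟩ (π′ ⟨$⟩ l) ≡ σ ⟨$⟩ (σ′ ⟨$⟩ l)) →
             ∀ a → π · π′ · a ≈ σ · σ′ · a
    ·-ext₂ π π′ σ σ′ eq a = begin
      π · π′ · a      ≈⟨ ·-∘ π π′ a ⟩
      (π ∘ₚ π′) · a   ≈⟨ ·-ext (π ∘ₚ π′) (σ ∘ₚ σ′) eq a ⟩
      (σ ∘ₚ σ′) · a   ≈⟨ ·-∘ σ σ′ a ⟨
      σ · σ′ · a      ∎
      where open ≈-Reasoning

    conj-fixes : ∀ π σ L → σ Fixes map (π ⟨$⟩_) L → (π ⁻¹ ∘ₚ σ ∘ₚ π) Fixes L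
    conj-fixes π σ L fix {l} l∈L =
      ≡.trans (cong (Perm.from π) (fix (∈-map⁺ (π ⟨$⟩_) l∈L))) (Perm.from-to π l)

    supports-· : ∀ π {L a} → Supports L a → Supports (map (π ⟨$⟩_) L) (π · a)
    supports-· π {L} {a} sup σ fix = begin
      σ · π · a
        ≈⟨ ·-ext₂ σ π π (π ⁻¹ ∘ₚ σ ∘ₚ π) (λ l → ≡.sym (Perm.to-from π _)) a ⟩
      π · (π ⁻¹ ∘ₚ σ ∘ₚ π) · a
        ≈⟨ ·-cong π (sup _ (conj-fixes π σ L fix)) ⟩
      π · a ∎
      where open ≈-Reasoning

  record FMPoset : Set₁ where
    infix 4 _≤_
    field
      fmSet : FMSet
    open FMSet fmSet public
    field
      _≤_            : Rel Carrier 0ℓ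
      isPartialOrder : IsPartialOrder _≈_ _≤_
      ·-mono         : ∀ π {a b} → a ≤ b → π · a ≤ π · b

    open IsPartialOrder isPartialOrder public using (antisym)
      renaming (reflexive to ≤-reflexive; trans to ≤-trans; refl to ≤-refl)

    IsChain : (ℕ → Carrier) → Set
    IsChain s = ∀ n → s n ≤ s (suc n)

    FinSupported : (ℕ → Carrier) → Set
    FinSupported s = ∃[ L ] (∀ n → Supports L (s n))

    IsLub : (ℕ → Carrier) → Carrier → Set
    IsLub s a = (∀ n → s n ≤ a) × (∀ b → (∀ n → s n ≤ b) → a ≤ b)

    lub-unique : ∀ {s t a b} → (∀ n → s n ≈ t n) → IsLub s a → IsLub t b → a ≈ b
    lub-unique s≈t (s≤a , a-least) (t≤b , b-least) = antisym
      (a-least _ λ n → ≤-trans (≤-reflexive (s≈t n)) (t≤b n))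
      (b-least _ λ n → ≤-trans (≤-reflexive (≈-sym (s≈t n))) (s≤a n))

    lub-cong : ∀ {s a b} → a ≈ b → IsLub s a → IsLub s b
    lub-cong a≈b (ub , least) =
      (λ n → ≤-trans (ub n) (≤-reflexive a≈b)) ,
      (λ x x-ub → ≤-trans (≤-reflexive (≈-sym a≈b)) (least x x-ub))

    lub-· : ∀ π {s a} → IsLub s a → IsLub (λ n → π · s n) (π · a)
    lub-· π {s} {a} (ub , least) = (λ n → ·-mono π (ub n)) , λ b b-ub →
      ≤-trans (·-mono π (least (π ⁻¹ · b) λ n →
        ≤-trans (≤-reflexive (≈-sym (·-⁻¹ˡ π (s n)))) (·-mono (π ⁻¹) (b-ub n))))
      (≤-reflexive (·-⁻¹ʳ π b))

    chain-+ : ∀ {s} → IsChain s → ∀ k n → s k ≤ s (n + k)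
    chain-+ ch k zero    = ≤-refl
    chain-+ ch k (suc n) = ≤-trans (chain-+ ch k n) (ch (n + k))

  record FMCpo : Set₁ where
    field
      fmPoset : FMPoset
    open FMPoset fmPoset public
    field
      complete : ∀ s → IsChain s → FinSupported s → ∃[ a ] IsLub s a

  module _ (A B : FMCpo) where
    private
      module A = FMCpo A
      module B = FMCpo B

    -- Respect for ≈ is not a field: it follows from monotonicity (fun-cong).
    record Hom : Set where
      field
        fun      : A.Carrier → B.Carrier
        finSupp  : ∃[ L ] (∀ π → π Fixes L → ∀ a → π B.· fun (π ⁻¹ A.· a) B.≈ fun a)
        monotone : ∀ {a b} → a A.≤ b → fun a B.≤ fun b
        lubs     : ∀ s a → A.IsChain s → A.FinSupported s → A.IsLub s a →
                   B.IsLub (fun ∘ s) (fun a)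

      fun-cong : ∀ {a b} → a A.≈ b → fun a B.≈ fun b
      fun-cong a≈b = B.antisym (monotone (A.≤-reflexive a≈b))
                               (monotone (A.≤-reflexive (A.≈-sym a≈b)))

  open Hom public

  infixr 2 _⇒_
  _⇒_ : FMCpo → FMCpo → FMCpo
  A ⇒ B = record
    { fmPoset  = poset
    ; complete = λ s ch fs → sup s ch fs , sup-isLub s ch fs
    }
    where
    module A = FMCpo A
    module B = FMCpo B

    act : Perm → Hom A B → Hom A B
    act π f = record
      { fun      = λ a → π B.· fun f (π ⁻¹ A.· a)
      ; finSupp  = map (π ⟨$⟩_) L , supp
      ; monotone = λ a≤b → B.·-mono π (monotone f (A.·-mono (π ⁻¹) a≤b))
      ; lubs     = λ { s a ch (K , sup) lub →
          B.lub-· π (lubs f (λ n → π ⁻¹ A.· s n) (π ⁻¹ A.· a)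
            (λ n → A.·-mono (π ⁻¹) (ch n))
            (map (π ⁻¹ ⟨$⟩_) K , λ n → A.supports-· (π ⁻¹) (sup n))
            (A.lub-· (π ⁻¹) lub)) }
      }
      where
      L : List Loc
      L = proj₁ (finSupp f)
      supp : ∀ σ → σ Fixes map (π ⟨$⟩_) L → ∀ a →
             σ B.· π B.· fun f (π ⁻¹ A.· σ ⁻¹ A.· a) B.≈ π B.· fun f (π ⁻¹ A.· a)
      supp σ fix a = begin
        σ B.· π B.· fun f (π ⁻¹ A.· σ ⁻¹ A.· a)
          ≈⟨ B.·-ext₂ σ π π τ (λ l → ≡.sym (Perm.to-from π _)) _ ⟩
        π B.· τ B.· fun f (π ⁻¹ A.· σ ⁻¹ A.· a)
          ≈⟨ B.·-cong π (B.·-cong τ (fun-cong f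
               (A.·-ext₂ (π ⁻¹) (σ ⁻¹) (τ ⁻¹) (π ⁻¹)
                 (λ l → cong (Perm.from π ∘ Perm.from σ) (≡.sym (Perm.to-from π l))) a))) ⟩
        π B.· τ B.· fun f (τ ⁻¹ A.· π ⁻¹ A.· a)
          ≈⟨ B.·-cong π (proj₂ (finSupp f) τ (A.conj-fixes π σ L fix) (π ⁻¹ A.· a)) ⟩
        π B.· fun f (π ⁻¹ A.· a) ∎
        where
        open B.≈-Reasoning
        τ : Perm
        τ = π ⁻¹ ∘ₚ σ ∘ₚ π

    fset : FMSet
    fset = record
      { setoid = record
        { Carrier = Hom A B
        ; _≈_ = λ f g → ∀ a → fun f a B.≈ fun g a
        ; isEquivalence = record
          { refl = λ a → B.≈-refl
          ; sym = λ eq a → B.≈-sym (eq a)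
          ; trans = λ eq eq′ a → B.≈-trans (eq a) (eq′ a)
          }
        }
      ; _·_ = act
      ; ·-cong = λ π eq a → B.·-cong π (eq (π ⁻¹ A.· a))
      ; ·-id = λ f a → B.≈-trans (B.·-id _)
          (fun-cong f (A.·-trivial (idₚ ⁻¹) (λ _ → refl) a))
      ; ·-∘ = λ π π′ f a → B.≈-trans (B.·-∘ π π′ _)
          (B.·-cong (π ∘ₚ π′) (fun-cong f (A.≈-trans (A.·-∘ (π′ ⁻¹) (π ⁻¹) a)
            (A.·-ext (π′ ⁻¹ ∘ₚ π ⁻¹) ((π ∘ₚ π′) ⁻¹) (λ _ → refl) a))))
      ; supported = finSupp
      }

    poset : FMPoset
    poset = record
      { fmSet = fset
      ; _≤_ = λ f g → ∀ a → fun f a B.≤ fun g a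
      ; isPartialOrder = record
        { isPreorder = record
          { isEquivalence = Setoid.isEquivalence (FMSet.setoid fset)
          ; reflexive = λ eq a → B.≤-reflexive (eq a)
          ; trans = λ p q a → B.≤-trans (p a) (q a)
          }
        ; antisym = λ p q a → B.antisym (p a) (q a)
        }
      ; ·-mono = λ π f≤g a → B.·-mono π (f≤g (π ⁻¹ A.· a))
      }

    module F = FMPoset poset

    module _ (s : ℕ → Hom A B) (ch : F.IsChain s) (fs : F.FinSupported s) where
      lubAt : ∀ a → ∃[ b ] B.IsLub (λ n → fun (s n) a) b
      lubAt a = B.complete (λ n → fun (s n) a) (λ n → ch n a)
        ( proj₁ fs ++ proj₁ (A.supported a)
        , λ n π fix → B.≈-trans
            (B.·-cong π (fun-cong (s n) (A.≈-sym (proj₂ (A.supported a) (π ⁻¹)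
              (fixes-⁻¹ {π} (fixes-++ʳ {π} (proj₁ fs) fix))))))
            (proj₂ fs n π (fixes-++ˡ {π} fix) a))

      sup : Hom A B
      sup = record
        { fun = λ a → proj₁ (lubAt a)
        ; finSupp = proj₁ fs , λ π fix a → B.lub-unique
            (λ n → proj₂ fs n π fix a)
            (B.lub-· π (proj₂ (lubAt (π ⁻¹ A.· a))))
            (proj₂ (lubAt a))
        ; monotone = mono
        ; lubs = λ t a tch tfs lub →
            (λ m → mono (proj₁ lub m)) ,
            (λ b ub → proj₂ (proj₂ (lubAt a)) b λ n →
              proj₂ (lubs (s n) t a tch tfs lub) b λ m →
                B.≤-trans (proj₁ (proj₂ (lubAt (t m))) n) (ub m))
        }
        where
        mono : ∀ {a b} → a A.≤ b → proj₁ (lubAt a) B.≤ proj₁ (lubAt b)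
        mono {a} {b} a≤b = proj₂ (proj₂ (lubAt a)) _ λ n →
          B.≤-trans (monotone (s n) a≤b) (proj₁ (proj₂ (lubAt b)) n)

      sup-isLub : F.IsLub s sup
      sup-isLub = (λ n a → proj₁ (proj₂ (lubAt a)) n) ,
                  (λ g ub a → proj₂ (proj₂ (lubAt a)) (fun g a) (λ n → ub n a))

  ⟪_⇒_⟫ : FMCpo → FMCpo → Set
  ⟪ A ⇒ B ⟫ = FMCpo.Carrier (A ⇒ B)

  lub-pointwise : ∀ A B s f →
    FMCpo.IsChain (A ⇒ B) s → FMCpo.FinSupported (A ⇒ B) s → FMCpo.IsLub (A ⇒ B) s f →
    ∀ a → FMCpo.IsLub B (λ n → fun (s n) a) (fun f a)
  lub-pointwise A B s f ch fs lub a =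
    B.lub-cong (F.lub-unique {s} {s} {proj₁ (F.complete s ch fs)} {f} (λ n _ → B.≈-refl) (proj₂ (F.complete s ch fs)) lub a)
      ((λ n → proj₁ (proj₂ (F.complete s ch fs)) n a) , least)
    where
    module B = FMCpo B
    module F = FMCpo (A ⇒ B)
    least : ∀ b → (∀ n → fun (s n) a B.≤ b) → fun (proj₁ (F.complete s ch fs)) a B.≤ b
    least b ub = proj₂ (proj₂ (B.complete _ _ _)) b ub

  infixr 3 _×ᶜ_
  _×ᶜ_ : FMCpo → FMCpo → FMCpo
  A ×ᶜ B = record
    { fmPoset = record
      { fmSet = record
        { setoid = ×-setoid A.setoid B.setoid
        ; _·_ = λ { π (a , b) → π A.· a , π B.· b }
        ; ·-cong = λ { π (p , q) → A.·-cong π p , B.·-cong π q }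
        ; ·-id = λ { (a , b) → A.·-id a , B.·-id b }
        ; ·-∘ = λ { π π′ (a , b) → A.·-∘ π π′ a , B.·-∘ π π′ b }
        ; supported = λ { (a , b) →
            proj₁ (A.supported a) ++ proj₁ (B.supported b) , λ π fix →
              proj₂ (A.supported a) π (fixes-++ˡ {π} fix) ,
              proj₂ (B.supported b) π (fixes-++ʳ {π} (proj₁ (A.supported a)) fix) }
        }
      ; _≤_ = λ { (a , b) (a′ , b′) → (a A.≤ a′) × (b B.≤ b′) }
      ; isPartialOrder = ×-isPartialOrder A.isPartialOrder B.isPartialOrder
      ; ·-mono = λ { π (p , q) → A.·-mono π p , B.·-mono π q }
      }
    ; complete = λ { s ch (L , sup) →
        let a , (ubA , leastA) = A.complete (proj₁ ∘ s) (proj₁ ∘ ch) (L , λ n π fix → proj₁ (sup n π fix))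
            b , (ubB , leastB) = B.complete (proj₂ ∘ s) (proj₂ ∘ ch) (L , λ n π fix → proj₂ (sup n π fix))
        in (a , b) , (λ n → ubA n , ubB n) ,
           (λ { (x , y) ub → leastA x (proj₁ ∘ ub) , leastB y (proj₂ ∘ ub) }) }
    }
    where
    module A = FMCpo A
    module B = FMCpo B

  infixr 1 _⊎ˢ_
  _⊎ˢ_ : FMSet → FMSet → FMSet
  X ⊎ˢ Y = record
    { setoid = ⊎-setoid X.setoid Y.setoid
    ; _·_ = λ { π (inj₁ x) → inj₁ (π X.· x) ; π (inj₂ y) → inj₂ (π Y.· y) }
    ; ·-cong = λ { π (inj₁ p) → inj₁ (X.·-cong π p) ; π (inj₂ q) → inj₂ (Y.·-cong π q) }
    ; ·-id = λ { (inj₁ x) → inj₁ (X.·-id x) ; (inj₂ y) → inj₂ (Y.·-id y) }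
    ; ·-∘ = λ { π π′ (inj₁ x) → inj₁ (X.·-∘ π π′ x) ; π π′ (inj₂ y) → inj₂ (Y.·-∘ π π′ y) }
    ; supported = λ { (inj₁ x) → proj₁ (X.supported x) , λ π fix → inj₁ (proj₂ (X.supported x) π fix)
                    ; (inj₂ y) → proj₁ (Y.supported y) , λ π fix → inj₂ (proj₂ (Y.supported y) π fix) }
    }
    where
    module X = FMSet X
    module Y = FMSet Y

  Trivial : Set → FMSet
  Trivial X = record
    { setoid = ≡.setoid X
    ; _·_ = λ _ x → x
    ; ·-cong = λ _ → id
    ; ·-id = λ _ → refl
    ; ·-∘ = λ _ _ _ → refl
    ; supported = λ _ → [] , λ _ _ → refl
    }

  Discrete : FMSet → FMCpo
  Discrete X = record
    { fmPoset = record
      { fmSet = X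
      ; _≤_ = X._≈_
      ; isPartialOrder = record
        { isPreorder = record
          { isEquivalence = Setoid.isEquivalence X.setoid
          ; reflexive = id
          ; trans = X.≈-trans
          }
        ; antisym = λ p _ → p
        }
      ; ·-mono = X.·-cong
      }
    ; complete = λ s ch _ → s 0 , const s ch , λ b ub → ub 0
    }
    where
    module X = FMSet X
    const : ∀ s → (∀ n → s n X.≈ s (suc n)) → ∀ n → s n X.≈ s 0
    const s ch zero    = X.≈-refl
    const s ch (suc n) = X.≈-trans (X.≈-sym (ch n)) (const s ch n)

  infix 20 _⊥ᶜ
  _⊥ᶜ : FMCpo → FMCpo
  A ⊥ᶜ = record { fmPoset = poset ; complete = comp }
    where
    module A = FMCpo A
    open AddBottomEq A._≈_
    open AddBottomOrd A._≤_

    act : Perm → A.Carrier ₋ → A.Carrier ₋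
    act π = Maybe.map (π A.·_)

    poset : FMPoset
    poset = record
      { fmSet = record
        { setoid = record
          { _≈_ = _≈₋_
          ; isEquivalence = ≈₋-isEquivalence (Setoid.isEquivalence A.setoid) }
        ; _·_ = act
        ; ·-cong = λ { π ⊥₋≈⊥₋ → ⊥₋≈⊥₋ ; π [ p ] → [ A.·-cong π p ] }
        ; ·-id = λ { ⊥₋ → ⊥₋≈⊥₋ ; [ a ] → [ A.·-id a ] }
        ; ·-∘ = λ { π π′ ⊥₋ → ⊥₋≈⊥₋ ; π π′ [ a ] → [ A.·-∘ π π′ a ] }
        ; supported = λ { ⊥₋ → [] , λ _ _ → ⊥₋≈⊥₋
                        ; [ a ] → proj₁ (A.supported a) , λ π fix → [ proj₂ (A.supported a) π fix ] }
        }
      ; _≤_ = _≤₋_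
      ; isPartialOrder = ≤₋-isPartialOrder A.isPartialOrder
      ; ·-mono = λ { π (⊥₋≤ _) → ⊥₋≤ _ ; π [ p ] → [ A.·-mono π p ] }
      }

    module P = FMPoset poset

    above : ∀ {a x} → [ a ] ≤₋ x → ∃[ b ] x ≡ [ b ]
    above [ _ ] = _ , refl

    comp : ∀ s → P.IsChain s → P.FinSupported s → ∃[ a ] P.IsLub s a
    comp s ch (L , sup) with em {∃₂ λ n a → s n ≡ [ a ]}
    ... | no allBottom = ⊥₋ , (λ n → below (s n) refl) , (λ b _ → ⊥₋≤ b)
      where
      below : ∀ {n} x → s n ≡ x → x ≤₋ ⊥₋
      below ⊥₋    eq = ⊥₋≤ ⊥₋
      below [ a ] eq = ⊥-elim (allBottom (_ , a , eq))
    ... | yes (n , a , sn≡a) = [ proj₁ lub ] , ub , least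
      where
      tail : ∀ m → ∃[ b ] s (m + n) ≡ [ b ]
      tail zero    = a , sn≡a
      tail (suc m) = above (subst (_≤₋ s (suc m + n)) (proj₂ (tail m)) (ch (m + n)))

      t : ℕ → A.Carrier
      t m = proj₁ (tail m)

      lub : ∃[ b ] A.IsLub t b
      lub = A.complete t
        (λ m → [≤]-injective (subst₂ _≤₋_ (proj₂ (tail m)) (proj₂ (tail (suc m))) (ch (m + n))))
        (L , λ m π fix → [≈]-injective (subst (λ x → act π x ≈₋ x) (proj₂ (tail m)) (sup (m + n) π fix)))

      ub : ∀ k → s k ≤₋ [ proj₁ lub ]
      ub k = P.≤-trans
        (subst (λ i → s k ≤₋ s i) (+-comm n k) (P.chain-+ ch k n))
        (subst (_≤₋ [ proj₁ lub ]) (≡.sym (proj₂ (tail k))) [ proj₁ (proj₂ lub) k ])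

      least : ∀ x → (∀ k → s k ≤₋ x) → [ proj₁ lub ] ≤₋ x
      least x x-ub with above (subst (_≤₋ x) sn≡a (x-ub n))
      ... | y , refl = [ proj₂ (proj₂ lub) y (λ m →
              [≤]-injective (subst (_≤₋ [ y ]) (proj₂ (tail m)) (x-ub (m + n)))) ]

  data Val : Set where
    loc     : Loc → Val
    int     : ℤ → Val
    default : Val

  actVal : Perm → Val → Val
  actVal π (loc l) = loc (π ⟨$⟩ l)
  actVal π (int i) = int i
  actVal π default = default

  actCell : Perm → Val × Val → Val × Val
  actCell π (v , w) = actVal π v , actVal π w

  record Heap : Set where
    field
      lookup : Loc → Maybe (Val × Val)
      finite : ∃[ L ] (∀ l {c} → lookup l ≡ just c → l ∈ L)
  open Heap

  dom : Heap → Pred Loc 0ℓ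
  dom h l = ∃[ c ] lookup h l ≡ just c

  infix 4 _≈ᴴ_
  _≈ᴴ_ : Rel Heap 0ℓ
  h ≈ᴴ h′ = ∀ l → lookup h l ≡ lookup h′ l

  private
    map-just : ∀ {A B : Set} (f : A → B) x {y} → Maybe.map f x ≡ just y → ∃[ a ] x ≡ just a
    map-just f (just a) _ = a , refl

    actCell-id : ∀ c → actCell idₚ c ≡ c
    actCell-id (v , w) = cong₂ _,_ (go v) (go w)
      where
      go : ∀ v → actVal idₚ v ≡ v
      go (loc _) = refl
      go (int _) = refl
      go default = refl

    actCell-∘ : ∀ π π′ c → actCell π (actCell π′ c) ≡ actCell (π ∘ₚ π′) c
    actCell-∘ π π′ (v , w) = cong₂ _,_ (go v) (go w)
      where
      go : ∀ v → actVal π (actVal π′ v) ≡ actVal (π ∘ₚ π′) v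
      go (loc _) = refl
      go (int _) = refl
      go default = refl

    locs : Val → List Loc
    locs (loc l) = l ∷ []
    locs _       = []

    cellLocs : Maybe (Val × Val) → List Loc
    cellLocs (just (v , w)) = locs v ++ locs w
    cellLocs nothing        = []

    actVal-fix : ∀ π v → π Fixes locs v → actVal π v ≡ v
    actVal-fix π (loc l) fix = cong loc (fix (here refl))
    actVal-fix π (int i) fix = refl
    actVal-fix π default fix = refl

    actCell-fix : ∀ π c → π Fixes cellLocs (just c) → actCell π c ≡ c
    actCell-fix π (v , w) fix = cong₂ _,_
      (actVal-fix π v (fixes-++ˡ {π} fix)) (actVal-fix π w (fixes-++ʳ {π} (locs v) fix))

  actHeap : Perm → Heap → Heap
  actHeap π h = record
    { lookup = λ l → Maybe.map (actCell π) (lookup h (π ⁻¹ ⟨$⟩ l))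
    ; finite = map (π ⟨$⟩_) (proj₁ (finite h)) , λ l eq →
        subst (_∈ map (π ⟨$⟩_) (proj₁ (finite h))) (Perm.to-from π l)
          (∈-map⁺ (π ⟨$⟩_) (proj₂ (finite h) (π ⁻¹ ⟨$⟩ l) (proj₂ (map-just (actCell π) _ eq))))
    }

  HeapSet : FMSet
  HeapSet = record
    { setoid = record
      { Carrier = Heap
      ; _≈_ = _≈ᴴ_
      ; isEquivalence = record
        { refl = λ _ → refl
        ; sym = λ eq l → ≡.sym (eq l)
        ; trans = λ eq eq′ l → ≡.trans (eq l) (eq′ l)
        }
      }
    ; _·_ = actHeap
    ; ·-cong = λ π eq l → cong (Maybe.map (actCell π)) (eq (π ⁻¹ ⟨$⟩ l))
    ; ·-id = λ h l → ≡.trans (map-cong actCell-id (lookup h l)) (map-id (lookup h l))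
    ; ·-∘ = λ π π′ h l → let x = lookup h (π′ ⁻¹ ⟨$⟩ (π ⁻¹ ⟨$⟩ l)) in
        ≡.trans (≡.sym (map-∘ x)) (map-cong (actCell-∘ π π′) x)
    ; supported = λ h → supp h , sup h
    }
    where
    supp : Heap → List Loc
    supp h = let L = proj₁ (finite h) in L ++ concatMap (cellLocs ∘ lookup h) L

    sup : ∀ h π → π Fixes supp h → actHeap π h ≈ᴴ h
    sup h π fix l with lookup h (π ⁻¹ ⟨$⟩ l) in eq
    ... | nothing with lookup h l in eq′
    ...   | nothing = refl
    ...   | just c  = contradiction
      (≡.trans (≡.sym eq′) (≡.trans (cong (lookup h) (≡.sym
        (fixes-⁻¹ {π} fix (∈-++⁺ˡ (proj₂ (finite h) l eq′))))) eq)) λ ()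
    sup h π fix l | just c = begin
      just (actCell π c)
        ≡⟨ cong just (actCell-fix π c λ {m} m∈ →
             fix (∈-++⁺ʳ L (∈-concatMap⁺ (cellLocs ∘ lookup h)
               (Any.map (λ { {x} refl → subst (λ z → m ∈ cellLocs z) (≡.sym eq) m∈ }) l∈)))) ⟩
      just c                    ≡⟨ eq ⟨
      lookup h (π ⁻¹ ⟨$⟩ l)     ≡⟨ cong (lookup h) (≡.trans (≡.sym (fix (∈-++⁺ˡ l∈))) (Perm.to-from π l)) ⟩
      lookup h l                ∎
      where
      open ≡.≡-Reasoning
      L : List Loc
      L = proj₁ (finite h)
      l∈ : π ⁻¹ ⟨$⟩ l ∈ L
      l∈ = proj₂ (finite h) _ eq

  Heapᶜ : FMCpo
  Heapᶜ = Discrete HeapSet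

  data Outcome : Set where
    normal err : Outcome

  O : FMCpo
  O = Discrete (Trivial Outcome) ⊥ᶜ

  G : Pred (FMCpo.Carrier O) 0ℓ
  G x = x ≡ [ normal ] ⊎ x ≡ ⊥₋

  -- The codomain (Heap + {err})⊥ of the functions being transformed: heaps are
  -- [ inj₁ h ], err is [ inj₂ tt ].
  HeapErr⊥ : FMCpo
  HeapErr⊥ = Discrete (HeapSet ⊎ˢ Trivial ⊤) ⊥ᶜ

  Contᶜ : FMCpo
  Contᶜ = Heapᶜ ⇒ O

  Cont : Set
  Cont = FMCpo.Carrier Contᶜ

  infix 4 _#_
  _#_ : Rel Heap 0ℓ
  h # h′ = ∀ l → dom h l → dom h′ l → ⊥

  -- The partial operation takes its definedness proof as an argument; given
  -- disjointness, the left-biased choice is the union.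
  infix 6 _•_[_]
  _•_[_] : (h h′ : Heap) → h # h′ → Heap
  h • h′ [ _ ] = record
    { lookup = λ l → lookup h l <∣> lookup h′ l
    ; finite = proj₁ (finite h) ++ proj₁ (finite h′) , λ l eq → fin l eq
    }
    where
    fin : ∀ l {c} → (lookup h l <∣> lookup h′ l) ≡ just c →
          l ∈ proj₁ (finite h) ++ proj₁ (finite h′)
    fin l eq with lookup h l in eq′
    ... | just _  = ∈-++⁺ˡ (proj₂ (finite h) l eq′)
    ... | nothing = ∈-++⁺ʳ (proj₁ (finite h)) (proj₂ (finite h′) l eq)

  record FinSuppSubset : Set₁ where
    field
      mem     : Pred Heap 0ℓ
      resp    : ∀ {h h′} → h ≈ᴴ h′ → mem h → mem h′
      finSupp : ∃[ L ] (∀ π → π Fixes L → ∀ h → mem h ⇔ mem (actHeap π h))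
  open FinSuppSubset using (mem)

  infix 4 _∈ᴴ_
  _∈ᴴ_ : Heap → FinSuppSubset → Set
  h ∈ᴴ p = mem p h

  record ℛ : Set₁ where
    field
      rel     : Rel Heap 0ℓ
      resp    : ∀ {h₀ h₀′ h₁ h₁′} → h₀ ≈ᴴ h₀′ → h₁ ≈ᴴ h₁′ → rel h₀ h₁ → rel h₀′ h₁′
      finSupp : ∃[ L ] (∀ π → π Fixes L → ∀ h₀ h₁ →
                  rel h₀ h₁ ⇔ rel (actHeap π h₀) (actHeap π h₁))
  open ℛ using (rel)

  eq : (X : FMSet) → Pred (FMSet.Carrier X) 0ℓ → Rel (FMSet.Carrier X) 0ℓ
  eq X D x y = ∃[ d ] D d × x ≈ d × y ≈ d
    where open FMSet X

  eqᴿ : FinSuppSubset → ℛ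
  eqᴿ p = record
    { rel = eq HeapSet (mem p)
    ; resp = λ { {h₀} {h₀′} {h₁} {h₁′} e₀ e₁ (d , d∈p , h₀≈d , h₁≈d) →
        d , d∈p , ≈-trans {h₀′} {h₀} {d} (≈-sym {h₀} {h₀′} e₀) h₀≈d ,
                  ≈-trans {h₁′} {h₁} {d} (≈-sym {h₁} {h₁′} e₁) h₁≈d }
    ; finSupp = proj₁ (FinSuppSubset.finSupp p) , λ π fix h₀ h₁ →
        let sup = proj₂ (FinSuppSubset.finSupp p) π fix in mk⇔
        (λ { (d , d∈p , e₀ , e₁) →
          π · d , Equivalence.to (sup d) d∈p , ·-cong π {h₀} {d} e₀ , ·-cong π {h₁} {d} e₁ })
        (λ { (d , d∈p , e₀ , e₁) →
          h₀ , Equivalence.from (sup h₀) (FinSuppSubset.resp p (≈-sym {π · h₀} {d} e₀) d∈p) ,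
          ≈-refl {h₀} ,
          cancel π h₁ h₀ (≈-trans {π · h₁} {d} {π · h₀} e₁ (≈-sym {π · h₀} {d} e₀)) })
    }
    where
    open FMSet HeapSet
    cancel : ∀ π h h′ → π · h ≈ π · h′ → h ≈ h′
    cancel π h h′ e = ≈-trans {h} {π ⁻¹ · π · h} {h′} (≈-sym {π ⁻¹ · π · h} {h} (·-⁻¹ˡ π h))
      (≈-trans {π ⁻¹ · π · h} {π ⁻¹ · π · h′} {h′}
        (·-cong (π ⁻¹) {π · h} {π · h′} e) (·-⁻¹ˡ π h′))

  infixr 7 _⋆_
  _⋆_ : Rel Heap 0ℓ → Rel Heap 0ℓ → Rel Heap 0ℓ
  (r ⋆ s) h₀ h₁ =
    ∃[ n₀ ] ∃[ m₀ ] ∃[ n₁ ] ∃[ m₁ ]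
      (Σ[ d₀ ∈ n₀ # m₀ ] h₀ ≈ᴴ n₀ • m₀ [ d₀ ]) ×
      (Σ[ d₁ ∈ n₁ # m₁ ] h₁ ≈ᴴ n₁ • m₁ [ d₁ ]) ×
      r n₀ n₁ × s m₀ m₁

  eqG : Rel (FMCpo.Carrier O) 0ℓ
  eqG = eq (FMCpo.fmSet O) G

  [_→eqG] : Rel Heap 0ℓ → Rel Cont 0ℓ
  [ r →eqG] k₀ k₁ = ∀ h₀ h₁ → r h₀ h₁ → eqG (fun k₀ h₀) (fun k₁ h₁)

  [_]⟨_,_⟩[_] : ℛ → ⟪ Heapᶜ ×ᶜ Contᶜ ⇒ O ⟫ → ⟪ Heapᶜ ×ᶜ Contᶜ ⇒ O ⟫ → ℛ → Set₁
  [ r ]⟨ c₀ , c₁ ⟩[ s ] =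
    (r′ : ℛ) (h₀ h₁ : Heap) (k₀ k₁ : Cont) →
    (rel r ⋆ rel r′) h₀ h₁ →
    [ rel s ⋆ rel r′ →eqG] k₀ k₁ →
    eqG (fun c₀ (h₀ , k₀)) (fun c₁ (h₁ , k₁))

  cpsCase : FMCpo.Carrier HeapErr⊥ → Cont → FMCpo.Carrier O
  cpsCase ⊥₋           k = ⊥₋
  cpsCase [ inj₁ h ]   k = fun k h
  cpsCase [ inj₂ tt ]  k = [ err ]

  cps : ⟪ Heapᶜ ⇒ HeapErr⊥ ⟫ → ⟪ Heapᶜ ×ᶜ Contᶜ ⇒ O ⟫
  cps c = record
    { fun      = λ { (h , k) → cpsCase (fun c h) k }
    ; finSupp  = proj₁ (finSupp c) , λ { π fix (h , k) →
        O.≈-trans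
          (equivariant π (fun c (π ⁻¹ H.· h)) k)
          (case-cong k (proj₂ (finSupp c) π fix h)) }
    ; monotone = λ { {h , k} {h′ , k′} (h≈h′ , k≤k′) →
        O.≤-trans (case-mono (fun c h) k≤k′)
          (O.≤-reflexive (case-cong k′ (fun-cong c h≈h′))) }
    ; lubs     = λ { s (h , k) ch fs lub →
        (λ n → O.≤-trans
          (case-mono (fun c (proj₁ (s n))) (proj₂ (proj₁ lub n)))
          (O.≤-reflexive (case-cong k (fun-cong c (proj₁ (proj₁ lub n)))))) ,
        (λ b ub → case-least (fun c h) (proj₂ ∘ s) k
          (λ a → lub-pointwise Heapᶜ O (proj₂ ∘ s) k (proj₂ ∘ ch)
            (proj₁ fs , λ n π fix → proj₂ (proj₂ fs n π fix))
            ( (λ n → proj₂ (proj₁ lub n))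
            , (λ k′ k′-ub → proj₂ (proj₂ lub (h , k′) λ n → proj₁ (proj₁ lub n) , k′-ub n)))
            a)
          b
          (λ n → O.≤-trans
            (O.≤-reflexive (case-cong (proj₂ (s n))
              (E.≈-sym (fun-cong c (proj₁ (proj₁ lub n))))))
            (ub n))) }
    }
    where
    module O = FMCpo O
    module E = FMCpo HeapErr⊥
    module H = FMCpo Heapᶜ
    module K = FMCpo Contᶜ
    open AddBottomEq using (⊥₋≈⊥₋; [_])
    open AddBottomOrd using (⊥₋≤_; [_])

    case-cong : ∀ {x y} k → x E.≈ y → cpsCase x k O.≈ cpsCase y k
    case-cong k ⊥₋≈⊥₋       = ⊥₋≈⊥₋
    case-cong k ([_] {inj₁ h} {inj₁ h′} (inj₁ e)) = fun-cong k {h} {h′} e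
    case-cong k [ inj₂ _ ]  = O.≈-refl

    case-mono : ∀ x {k k′} → k K.≤ k′ → cpsCase x k O.≤ cpsCase x k′
    case-mono ⊥₋          _    = O.≤-refl
    case-mono [ inj₁ h ]  k≤k′ = k≤k′ h
    case-mono [ inj₂ _ ]  _    = O.≤-refl

    equivariant : ∀ π x k → π O.· cpsCase x (π ⁻¹ K.· k) O.≈ cpsCase (π E.· x) k
    equivariant π ⊥₋         k = O.≈-refl
    equivariant π [ inj₁ h ] k = O.≈-trans (O.·-⁻¹ʳ π _)
      (fun-cong k (H.·-ext ((π ⁻¹) ⁻¹) π (λ _ → refl) h))
    equivariant π [ inj₂ _ ] k = O.≈-refl

    case-least : ∀ x (ks : ℕ → Cont) k → (∀ a → O.IsLub (λ n → fun (ks n) a) (fun k a)) →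
                 ∀ b → (∀ n → cpsCase x (ks n) O.≤ b) → cpsCase x k O.≤ b
    case-least ⊥₋         ks k lub b ub = ub 0
    case-least [ inj₁ h ] ks k lub b ub = proj₂ (lub h) b ub
    case-least [ inj₂ _ ] ks k lub b ub = ub 0

{-# OPTIONS --safe #-}

-- A quadruple can be tested with a singleton frame r′ = {(u , v)} and the
-- continuations "normal on S, ⊥ elsewhere" and "normal on T, ⊥ elsewhere",
-- provided n • u ∈ S and n • v ∈ T are equivalent for n ∈ q: if c (h • u)
-- lands in S, then c (h • v) lands in T.  Condition (1) takes u = v = ∅,
-- S = Heap and T = q; condition (2a) takes u = h₁, v = ∅ and S = T = Heap;
-- condition (2b) takes u = ∅, v = h₁, S = {c h} and T = {c h • h₁}, or T = ∅
-- when c h • h₁ is undefined, which refutes that case.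
module Submission where

open import Axiom.ExcludedMiddle using (ExcludedMiddle)
open import Data.Empty using (⊥; ⊥-elim)
open import Data.List.Base using ([]; _++_)
open import Data.Maybe.Base using (just; nothing; _<∣>_)
open import Data.Nat.Base using (ℕ)
open import Data.Product using (_×_; _,_; proj₁; proj₂; Σ-syntax; ∃-syntax)
open import Data.Sum.Base using (_⊎_; inj₁; inj₂)
open import Data.Sum.Relation.Binary.Pointwise using (inj₁; inj₂)
open import Data.Unit.Base using (⊤; tt)
open import Function.Base using (id)
open import Function.Bundles using (_↔_; _⇔_; mk⇔; Equivalence)
open import Level using (0ℓ)
open import Relation.Binary.PropositionalEquality using (refl; sym; trans; cong₂)
import Relation.Binary.Construct.Add.Infimum.Equality as AddBottomEq
open import Relation.Nullary using (¬_; yes; no)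
open import Relation.Nullary.Construct.Add.Infimum using (⊥₋; [_])
open import Defs

module Characterisation (em : ExcludedMiddle 0ℓ) (Loc : Set) (countable : Loc ↔ ℕ) where
  open Semantics em Loc countable
  open Heap using (lookup)
  open AddBottomEq using (⊥₋≈⊥₋; [_])
  private
    module H = FMSet HeapSet
    module O = FMCpo O
    module E = FMCpo HeapErr⊥

  -- The empty heap and disjoint unions up to extensional equality.

  ∅ᴴ : Heap
  ∅ᴴ = record { lookup = λ _ → nothing ; finite = [] , λ _ () }

  #-∅ : ∀ h → h # ∅ᴴ
  #-∅ _ _ _ (_ , ())

  •-identityʳ : ∀ h (d : h # ∅ᴴ) → h • ∅ᴴ [ d ] ≈ᴴ h
  •-identityʳ h _ l with lookup h l
  ... | just _  = refl
  ... | nothing = refl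

  •-cong : ∀ {h h′ u u′} {d : h # u} {d′ : h′ # u′} →
           h ≈ᴴ h′ → u ≈ᴴ u′ → h • u [ d ] ≈ᴴ h′ • u′ [ d′ ]
  •-cong h≈h′ u≈u′ l = cong₂ _<∣>_ (h≈h′ l) (u≈u′ l)

  #-resp : ∀ {h h′ u u′} → h ≈ᴴ h′ → u ≈ᴴ u′ → h # u → h′ # u′
  #-resp h≈h′ u≈u′ d l (a , e) (b , f) =
    d l (a , trans (h≈h′ l) e) (b , trans (u≈u′ l) f)

  -- At a location in only one of `h` and `h′`, equality of the unions would force `u` to supply the
  -- missing cell, against disjointness.
  •-cancelʳ : ∀ {h h′ u} (d : h # u) (d′ : h′ # u) →
              h • u [ d ] ≈ᴴ h′ • u [ d′ ] → h ≈ᴴ h′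
  •-cancelʳ {h} {h′} {u} d d′ e l
    with lookup h l in hl | lookup h′ l in h′l | lookup u l in ul | e l
  ... | just _  | just _  | _       | e′   = e′
  ... | nothing | nothing | _       | _    = refl
  ... | just _  | nothing | just _  | _    = ⊥-elim (d l (_ , hl) (_ , ul))
  ... | nothing | just _  | just _  | _    = ⊥-elim (d′ l (_ , h′l) (_ , ul))

  -- Finitely supported subsets and relations used as tests and frames.

  constant : Set → FinSuppSubset
  constant A = record
    { mem = λ _ → A ; resp = λ _ → id ; finSupp = [] , λ _ _ _ → mk⇔ id id }

  ｛_｝ : Heap → FinSuppSubset
  ｛ a ｝ = record
    { mem     = _≈ᴴ a
    ; resp    = λ h≈h′ h≈a l → trans (sym (h≈h′ l)) (h≈a l)
    ; finSupp = proj₁ (H.supported a) , λ π fix h →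
        let πa≈a = proj₂ (H.supported a) π fix
            π⁻¹a≈a = proj₂ (H.supported a) (π ⁻¹) (fixes-⁻¹ {π} fix)
        in mk⇔
          (λ h≈a l → trans (H.·-cong π {h} {a} h≈a l) (πa≈a l))
          (λ πh≈a l → trans (sym (H.·-⁻¹ˡ π h l))
            (trans (H.·-cong (π ⁻¹) {actHeap π h} {a} πh≈a l) (π⁻¹a≈a l)))
    }

  infixr 2 _×ᴿ_
  -- A product of two singletons is a frame relation whose two sides may carry different heaps.
  _×ᴿ_ : FinSuppSubset → FinSuppSubset → ℛ
  S ×ᴿ T = record
    { rel     = λ h₀ h₁ → h₀ ∈ᴴ S × h₁ ∈ᴴ T
    ; resp    = λ { {h₀} {h₀′} {h₁} {h₁′} e₀ e₁ (s , t) →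
        S.resp {h₀} {h₀′} e₀ s , T.resp {h₁} {h₁′} e₁ t }
    ; finSupp = proj₁ S.finSupp ++ proj₁ T.finSupp , λ π fix h₀ h₁ →
        let S⇔ = proj₂ S.finSupp π (fixes-++ˡ {π} fix) h₀
            T⇔ = proj₂ T.finSupp π (fixes-++ʳ {π} (proj₁ S.finSupp) fix) h₁
        in mk⇔ (λ { (s , t) → Equivalence.to S⇔ s , Equivalence.to T⇔ t })
               (λ { (s , t) → Equivalence.from S⇔ s , Equivalence.from T⇔ t })
    }
    where
    module S = FinSuppSubset S
    module T = FinSuppSubset T

  -- Indicator continuations.

  truth : Set → O.Carrier
  truth A with em {A}
  ... | yes _ = [ normal ]
  ... | no  _ = ⊥₋

  truth-∈G : ∀ A → G (truth A)
  truth-∈G A with em {A}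
  ... | yes _ = inj₁ refl
  ... | no  _ = inj₂ refl

  truth-cong : ∀ {A B} → A ⇔ B → truth A O.≈ truth B
  truth-cong {A} {B} A⇔B with em {A} | em {B}
  ... | yes _ | yes _ = O.≈-refl
  ... | no  _ | no  _ = O.≈-refl
  ... | yes a | no ¬b = ⊥-elim (¬b (Equivalence.to A⇔B a))
  ... | no ¬a | yes b = ⊥-elim (¬a (Equivalence.from A⇔B b))

  truth-normal⁺ : ∀ {A} → A → truth A O.≈ [ normal ]
  truth-normal⁺ {A} a with em {A}
  ... | yes _ = O.≈-refl
  ... | no ¬a = ⊥-elim (¬a a)

  truth-normal⁻ : ∀ {A} → truth A O.≈ [ normal ] → A
  truth-normal⁻ {A} _ with em {A}
  truth-normal⁻ _  | yes a = a
  truth-normal⁻ () | no _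

  indicator : FinSuppSubset → Cont
  indicator S = record
    { fun      = λ h → truth (h ∈ᴴ S)
    -- Permutations act trivially on `O`, so only the invariance of `S` under `π ⁻¹` is at stake.
    ; finSupp  = proj₁ S.finSupp , λ π fix h → O.≈-trans
        (trivial π (truth (actHeap (π ⁻¹) h ∈ᴴ S)))
        (truth-cong (⇔-sym (proj₂ S.finSupp (π ⁻¹) (fixes-⁻¹ {π} fix) h)))
    ; monotone = λ {h} {h′} → mono {h} {h′}
    -- The order on heaps is equality, so `s 0` already equals the upper bound `h`.
    ; lubs     = λ s h _ _ (ub , _) →
        (λ n → mono {s n} {h} (ub n)) ,
        (λ b b-ub → O.≤-trans (mono {h} {s 0} (λ l → sym (ub 0 l))) (b-ub 0))
    }
    where
    module S = FinSuppSubset S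

    ⇔-sym : ∀ {A B : Set} → A ⇔ B → B ⇔ A
    ⇔-sym A⇔B = mk⇔ (Equivalence.from A⇔B) (Equivalence.to A⇔B)

    trivial : ∀ π x → π O.· x O.≈ x
    trivial π ⊥₋    = O.≈-refl
    trivial π [ _ ] = O.≈-refl

    mono : ∀ {h h′} → h ≈ᴴ h′ → truth (h ∈ᴴ S) O.≤ truth (h′ ∈ᴴ S)
    mono {h} {h′} h≈h′ = O.≤-reflexive (truth-cong
      (mk⇔ (S.resp {h} {h′} h≈h′) (S.resp {h′} {h} (λ l → sym (h≈h′ l)))))

  -- Reading results of `c` off outcomes related by `eqG`.

  cpsCase-cong : ∀ {x y} k → x E.≈ y → cpsCase x k O.≈ cpsCase y k
  cpsCase-cong k ⊥₋≈⊥₋                              = ⊥₋≈⊥₋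
  cpsCase-cong k ([_] {inj₁ h} {inj₁ h′} (inj₁ e))  = fun-cong k {h} {h′} e
  cpsCase-cong k [ inj₂ _ ]                         = O.≈-refl

  eqG-resp : ∀ {x x′ y y′} → x O.≈ x′ → y O.≈ y′ → eqG x′ y′ → eqG x y
  eqG-resp x≈x′ y≈y′ (g , g∈G , x′≈g , y′≈g) =
    g , g∈G , O.≈-trans x≈x′ x′≈g , O.≈-trans y≈y′ y′≈g

  Returns : FinSuppSubset → E.Carrier → Set
  Returns S x = ∃[ h ] x E.≈ [ inj₁ h ] × h ∈ᴴ S

  -- An error result yields the outcome `err` under every continuation, and `err` lies outside `G`.
  eqG-safe : ∀ x k {z} → eqG (cpsCase x k) z → x E.≈ ⊥₋ ⊎ Returns (constant ⊤) x
  eqG-safe ⊥₋         k _ = inj₁ ⊥₋≈⊥₋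
  eqG-safe [ inj₁ h ] k _ = inj₂ (h , E.≈-refl , tt)
  eqG-safe [ inj₂ _ ] k (_ , inj₁ refl , [ () ] , _)
  eqG-safe [ inj₂ _ ] k (_ , inj₂ refl , () , _)

  normal-returns : ∀ T y → cpsCase y (indicator T) O.≈ [ normal ] → Returns T y
  normal-returns T [ inj₁ h ] e = h , E.≈-refl , truth-normal⁻ e
  normal-returns T [ inj₂ _ ] [ () ]

  -- A result in `S` makes the left outcome `normal`, hence also the right one; there `normal` can
  -- only come from a heap in `T`.
  eqG-returns : ∀ S T {x y} → eqG (cpsCase x (indicator S)) (cpsCase y (indicator T)) →
                Returns S x → Returns T y
  eqG-returns S T {y = y} (_ , _ , x≈g , y≈g) (h , x≈h , h∈S) =
    normal-returns T y (O.≈-trans y≈g (O.≈-trans (O.≈-sym x≈g)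
      (O.≈-trans (cpsCase-cong (indicator S) x≈h) (truth-normal⁺ h∈S))))

  heap-injective : ∀ {h h′} → [ inj₁ h ] E.≈ [ inj₁ h′ ] → h ≈ᴴ h′
  heap-injective [ inj₁ e ] = e

  -- The two conditions.

  module _ (p q : FinSuppSubset) (c : ⟪ Heapᶜ ⇒ HeapErr⊥ ⟫) where

    TotallyCorrect : Set
    TotallyCorrect = ∀ h → h ∈ᴴ p → fun c h E.≈ ⊥₋ ⊎ Returns q (fun c h)

    Local : Set
    Local = ∀ h → h ∈ᴴ p → ∀ h₁ → (d : h # h₁) →
      (fun c h E.≈ ⊥₋ → fun c (h • h₁ [ d ]) E.≈ ⊥₋)
      ×
      (¬ (fun c h E.≈ ⊥₋) →
        ∃[ h′ ] (fun c h E.≈ [ inj₁ h′ ]) ×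
          (Σ[ d′ ∈ h′ # h₁ ] (fun c (h • h₁ [ d ]) E.≈ [ inj₁ (h′ • h₁ [ d′ ]) ])))

    -- From the quadruple to the two conditions.

    module _ (quadruple : [ eqᴿ p ]⟨ cps c , cps c ⟩[ eqᴿ q ]) where

      -- Heaps related by the postcondition and the singleton frame are `n • u` and `n • v` for a
      -- common `n` in `q`, up to equality. The last hypothesis therefore says that the two
      -- indicators agree on them.
      frame : ∀ {h u v} S T → h ∈ᴴ p → (d : h # u) (e : h # v) →
              (∀ n → n ∈ᴴ q → (d : n # u) (e : n # v) →
                (n • u [ d ]) ∈ᴴ S ⇔ (n • v [ e ]) ∈ᴴ T) →
              eqG (cpsCase (fun c (h • u [ d ])) (indicator S))
                  (cpsCase (fun c (h • v [ e ])) (indicator T))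
      frame {h} {u} {v} S T h∈p d e S⇔T =
        quadruple (｛ u ｝ ×ᴿ ｛ v ｝) _ _ (indicator S) (indicator T)
          ( h , u , h , v , (d , λ _ → refl) , (e , λ _ → refl)
          , (h , h∈p , (λ _ → refl) , λ _ → refl) , (λ _ → refl) , λ _ → refl )
          related
        where
        module S = FinSuppSubset S
        module T = FinSuppSubset T

        related : [ ℛ.rel (eqᴿ q) ⋆ ℛ.rel (｛ u ｝ ×ᴿ ｛ v ｝) →eqG] (indicator S) (indicator T)
        related g₀ g₁ (n₀ , m₀ , n₁ , m₁ , (d₀ , g₀≈) , (d₁ , g₁≈) ,
                       (n , n∈q , n₀≈n , n₁≈n) , m₀≈u , m₁≈v) =
          truth (g₁ ∈ᴴ T) , truth-∈G (g₁ ∈ᴴ T) , truth-cong S⇔T′ , O.≈-refl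
          where
          -- The given splittings are only equal to `n`, `u` and `v`, so disjointness is transported
          -- along these equalities.
          d′ : n # u
          d′ = #-resp {n₀} {n} {m₀} {u} n₀≈n m₀≈u d₀
          e′ : n # v
          e′ = #-resp {n₁} {n} {m₁} {v} n₁≈n m₁≈v d₁

          g₀≈n•u : g₀ ≈ᴴ n • u [ d′ ]
          g₀≈n•u l = trans (g₀≈ l) (•-cong {n₀} {n} {m₀} {u} {d₀} {d′} n₀≈n m₀≈u l)
          g₁≈n•v : g₁ ≈ᴴ n • v [ e′ ]
          g₁≈n•v l = trans (g₁≈ l) (•-cong {n₁} {n} {m₁} {v} {d₁} {e′} n₁≈n m₁≈v l)

          S⇔T′ : g₀ ∈ᴴ S ⇔ g₁ ∈ᴴ T
          S⇔T′ = mk⇔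
            (λ g₀∈S → T.resp (λ l → sym (g₁≈n•v l))
              (Equivalence.to (S⇔T n n∈q d′ e′) (S.resp g₀≈n•u g₀∈S)))
            (λ g₁∈T → S.resp (λ l → sym (g₀≈n•u l))
              (Equivalence.from (S⇔T n n∈q d′ e′) (T.resp g₁≈n•v g₁∈T)))

      c-∅ : ∀ h → fun c (h • ∅ᴴ [ #-∅ h ]) E.≈ fun c h
      c-∅ h = fun-cong c {h • ∅ᴴ [ #-∅ h ]} {h} (•-identityʳ h (#-∅ h))

      -- One outcome is read twice: its left side excludes `err`, and a returning left side, normal
      -- on every heap, forces the right side to return in `q`.
      totallyCorrect : TotallyCorrect
      totallyCorrect h h∈p = conclude (eqG-safe _ _ outcome)
        where
        outcome = frame (constant ⊤) q h∈p (#-∅ h) (#-∅ h) λ n n∈q _ e → mk⇔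
          (λ _ → FinSuppSubset.resp q {n} {n • ∅ᴴ [ e ]} (λ l → sym (•-identityʳ n e l)) n∈q)
          (λ _ → tt)

        conclude : fun c (h • ∅ᴴ [ #-∅ h ]) E.≈ ⊥₋ ⊎
                   Returns (constant ⊤) (fun c (h • ∅ᴴ [ #-∅ h ])) →
                   fun c h E.≈ ⊥₋ ⊎ Returns q (fun c h)
        conclude (inj₁ c≈⊥) = inj₁ (E.≈-trans (E.≈-sym (c-∅ h)) c≈⊥)
        conclude (inj₂ ret) =
          let h′ , e , h′∈q = eqG-returns (constant ⊤) q outcome ret
          in inj₂ (h′ , E.≈-trans (E.≈-sym (c-∅ h)) e , h′∈q)

      local : Local
      local h h∈p h₁ d = diverges , converges
        where
        outcome = frame (constant ⊤) (constant ⊤) h∈p d (#-∅ h) λ _ _ _ _ → mk⇔ id id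

        diverges : fun c h E.≈ ⊥₋ → fun c (h • h₁ [ d ]) E.≈ ⊥₋
        diverges c≈⊥ with eqG-safe _ _ outcome
        ... | inj₁ c≈⊥′ = c≈⊥′
        -- If `c` returned on the larger heap, it would return on `h • ∅ᴴ` and so on `h`, where it
        -- diverges.
        ... | inj₂ ret with eqG-returns (constant ⊤) (constant ⊤) outcome ret
        ...   | _ , e , _ with E.≈-trans (E.≈-sym c≈⊥) (E.≈-trans (E.≈-sym (c-∅ h)) e)
        ...     | ()

        -- The small heap is now on the left, tested against the known result `h′`. Since `n • ∅ᴴ`
        -- equals `n`, the frame hypothesis reduces to `spec`; `T` stays open to serve both cases of
        -- `h′ # h₁`.
        compare : ∀ h′ T → fun c h E.≈ [ inj₁ h′ ] →
                  (∀ n (e : n # h₁) → n ≈ᴴ h′ ⇔ (n • h₁ [ e ]) ∈ᴴ T) →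
                  Returns T (fun c (h • h₁ [ d ]))
        compare h′ T c≈h′ spec = eqG-returns ｛ h′ ｝ T
          (frame ｛ h′ ｝ T h∈p (#-∅ h) d λ n _ d₀ e → mk⇔
            (λ n•∅≈h′ → Equivalence.to (spec n e)
              λ l → trans (sym (•-identityʳ n d₀ l)) (n•∅≈h′ l))
            (λ n•h₁∈T l → trans (•-identityʳ n d₀ l) (Equivalence.from (spec n e) n•h₁∈T l)))
          (h′ , E.≈-trans (c-∅ h) c≈h′ , λ _ → refl)

        converges : ¬ (fun c h E.≈ ⊥₋) →
          ∃[ h′ ] (fun c h E.≈ [ inj₁ h′ ]) ×
            (Σ[ d′ ∈ h′ # h₁ ] (fun c (h • h₁ [ d ]) E.≈ [ inj₁ (h′ • h₁ [ d′ ]) ]))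
        converges c≉⊥ with totallyCorrect h h∈p
        ... | inj₁ c≈⊥ = ⊥-elim (c≉⊥ c≈⊥)
        ... | inj₂ (h′ , c≈h′ , _) with em {h′ # h₁}
        -- No `n` disjoint from `h₁` can equal `h′`, so both sides of the equivalence are false, and
        -- `c` would return a heap in the empty set.
        ...   | no ¬d′ = ⊥-elim (proj₂ (proj₂ (compare h′ (constant ⊥) c≈h′ λ n e →
                  mk⇔ (λ n≈h′ → ¬d′ (#-resp {n} {h′} {h₁} {h₁} n≈h′ (λ _ → refl) e)) λ ())))
        ...   | yes d′ =
          let _ , e , g≈ = compare h′ ｛ h′ • h₁ [ d′ ] ｝ c≈h′ λ n e → mk⇔
                (λ n≈h′ → •-cong {n} {h′} {h₁} {h₁} {e} {d′} n≈h′ λ _ → refl)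
                (•-cancelʳ {n} {h′} {h₁} e d′)
          in h′ , c≈h′ , d′ , E.≈-trans e [ inj₁ g≈ ]

    -- From the two conditions to the quadruple.

    module _ (correct : TotallyCorrect) (local : Local) where

      -- Both `n₀` and `n₁` equal a common heap in `p`, so `c` gives them the same result.
      -- Divergence persists on the larger heaps; a result in `q` is extended by the untouched
      -- frames `m₀` and `m₁`, still related by `r′`, and the hypothesis on the continuations
      -- applies.
      frame-quadruple : [ eqᴿ p ]⟨ cps c , cps c ⟩[ eqᴿ q ]
      frame-quadruple r′ h₀ h₁ k₀ k₁
        (n₀ , m₀ , n₁ , m₁ , (d₀ , h₀≈) , (d₁ , h₁≈) , (n , n∈p , n₀≈n , n₁≈n) , m₀r′m₁) k₀k₁ =
        eqG-resp (cpsCase-cong k₀ (c-cong h₀≈)) (cpsCase-cong k₁ (c-cong h₁≈))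
          (conclude (correct n₀ n₀∈p))
        where
        c-cong : ∀ {h h′} → h ≈ᴴ h′ → fun c h E.≈ fun c h′
        c-cong {h} {h′} = fun-cong c {h} {h′}

        n₀∈p : n₀ ∈ᴴ p
        n₀∈p = FinSuppSubset.resp p {n} {n₀} (λ l → sym (n₀≈n l)) n∈p
        n₁∈p : n₁ ∈ᴴ p
        n₁∈p = FinSuppSubset.resp p {n} {n₁} (λ l → sym (n₁≈n l)) n∈p

        cn₁≈cn₀ : fun c n₁ E.≈ fun c n₀
        cn₁≈cn₀ = c-cong (λ l → trans (n₁≈n l) (sym (n₀≈n l)))

        not-⊥ : ∀ {x h} → x E.≈ [ inj₁ h ] → ¬ (x E.≈ ⊥₋)
        not-⊥ () ⊥₋≈⊥₋

        conclude : fun c n₀ E.≈ ⊥₋ ⊎ Returns q (fun c n₀) →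
                   eqG (cpsCase (fun c (n₀ • m₀ [ d₀ ])) k₀) (cpsCase (fun c (n₁ • m₁ [ d₁ ])) k₁)
        conclude (inj₁ c≈⊥) =
          ⊥₋ , inj₂ refl
          , cpsCase-cong k₀ (proj₁ (local n₀ n₀∈p m₀ d₀) c≈⊥)
          , cpsCase-cong k₁ (proj₁ (local n₁ n₁∈p m₁ d₁) (E.≈-trans cn₁≈cn₀ c≈⊥))
        conclude (inj₂ (h′ , c≈h′ , h′∈q)) =
          -- Locality supplies its own result heaps `g₀` and `g₁`; both are identified with `h′`
          -- below by injectivity.
          let g₀ , c≈g₀ , e₀ , c•≈₀ = proj₂ (local n₀ n₀∈p m₀ d₀) (not-⊥ c≈h′)
              g₁ , c≈g₁ , e₁ , c•≈₁ = proj₂ (local n₁ n₁∈p m₁ d₁) (not-⊥ (E.≈-trans cn₁≈cn₀ c≈h′))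
          in eqG-resp (cpsCase-cong k₀ c•≈₀) (cpsCase-cong k₁ c•≈₁)
               (k₀k₁ (g₀ • m₀ [ e₀ ]) (g₁ • m₁ [ e₁ ])
                 ( g₀ , m₀ , g₁ , m₁ , (e₀ , λ _ → refl) , (e₁ , λ _ → refl)
                 , ( h′ , h′∈q
                   , heap-injective (E.≈-trans (E.≈-sym c≈g₀) c≈h′)
                   , heap-injective (E.≈-trans (E.≈-sym c≈g₁) (E.≈-trans cn₁≈cn₀ c≈h′)) )
                 , m₀r′m₁ ))

proposition7p1 :
  (em : ExcludedMiddle 0ℓ) (Loc : Set) (countable : Loc ↔ ℕ) →
  let open Semantics em Loc countable
      open FMCpo HeapErr⊥ using (_≈_) in
  (p q : FinSuppSubset) (c : ⟪ Heapᶜ ⇒ HeapErr⊥ ⟫) →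
  [ eqᴿ p ]⟨ cps c , cps c ⟩[ eqᴿ q ]
    ⇔
  ((∀ h → h ∈ᴴ p → (fun c h ≈ ⊥₋) ⊎ (∃[ h′ ] (fun c h ≈ [ inj₁ h′ ]) × (h′ ∈ᴴ q)))
   ×
   (∀ h → h ∈ᴴ p → ∀ h₁ → (d : h # h₁) →
     (fun c h ≈ ⊥₋ → fun c (h • h₁ [ d ]) ≈ ⊥₋)
     ×
     (¬ (fun c h ≈ ⊥₋) →
       ∃[ h′ ] (fun c h ≈ [ inj₁ h′ ]) ×
         (Σ[ d′ ∈ h′ # h₁ ] (fun c (h • h₁ [ d ]) ≈ [ inj₁ (h′ • h₁ [ d′ ]) ])))))
proposition7p1 em Loc countable p q c = mk⇔
  (λ quadruple → totallyCorrect p q c quadruple , local p q c quadruple)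
  (λ { (correct , loc) → frame-quadruple p q c correct loc })
  where open Characterisation em Loc countable
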